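{- The laws of the square of opposition are provable in the formal system $\mathrm{SYLL}^+$; that is, for all term-variables $X,Y$, the following logical consequences are provable in $\mathrm{SYLL}^+$: (1) (laws of contradiction) $\mathbf{A}_{XY},\mathbf{O}_{XY}\vdash\mathbf{O}_{XX}$ and $\mathbf{E}_{XY},\mathbf{I}_{XY}\vdash\mathbf{O}_{XX}$; (2) (laws of subalternation, contrariety and subcontrariety) $\mathbf{A}_{XY},\mathbf{I}_{XX}\vdash\mathbf{I}_{XY}$ and $\mathbf{E}_{XY},\mathbf{I}_{XX}\vdash\mathbf{O}_{XY}$.
   Context: **Diagrams.** The syntactic primitives are the symbols $\to$, $\leftarrow$, $\bullet$ and countably many term-variables $A,B,C,\dots$. A diagram is a finite list of arrow symbols ($\to$ or $\leftarrow$) separated by a single bullet or term-variable, beginning and ending at a term-variable (a single term-variable is a diagram). A part of a diagram is a finite list of consecutive components of it; parts are denoted $\mathcal{D},\mathcal{E}$. For term-variables $A,B$ (possibly equal) the four categorical propositions (Each $A$ is $B$; No $A$ is $B$; Some $A$ is $B$; Some $A$ is not $B$) are represented respectively by the syllogistic diagrams $$\mathbf{A}_{AB}: A\to B,\quad \mathbf{E}_{AB}: A\to\bullet\leftarrow B,\quad \mathbf{I}_{AB}: A\leftarrow\bullet\to B,\quad \mathbf{O}_{AB}: A\leftarrow\bullet\to\bullet\leftarrow B.$$ Here $\mathbf{I}_{XX}$ represents existential import on $X$ and $\mathbf{O}_{XX}$ expresses contradiction. **Rules of inference of $\mathrm{SYLL}^+$** (for all term-variables $A,B$ and all parts $\mathcal{D},\mathcal{E}$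 such that the expressions are diagrams): 1. from $A\to B$ infer $B\leftarrow A$, and conversely; 2. from $A\to\bullet\leftarrow B$ infer $B\to\bullet\leftarrow A$; 3. from $A\leftarrow\bullet\to B$ infer $B\leftarrow\bullet\to A$; 4. from $A\leftarrow\bullet\to\bullet\leftarrow B$ infer $B\to\bullet\leftarrow\bullet\to A$, and conversely; 5. from the two diagrams $\mathcal{D}A$ and $A\mathcal{E}$ (in either order) infer the diagram $\mathcal{D}A\mathcal{E}$ obtained by overlapping them on the common extremal $A$; 6. from $\mathcal{D}\to A\to\mathcal{E}$ infer $\mathcal{D}\to\mathcal{E}$; 7. from $\mathcal{D}\leftarrow A\leftarrow\mathcal{E}$ infer $\mathcal{D}\leftarrow\mathcal{E}$; 8. from no hypotheses infer $A\leftarrow\bullet\to A$. **Provability.** A proof tree is a tree in which each node is a diagram and each branching is an instance of a rule of inference. A logical consequence $P_1,P_2\vdash C$ between categorical propositions is provable if there is a proof tree with the diagram of $C$ as root and the diagrams of $P_1$ and $P_2$ as leaves (a premise $\mathbf{I}_{XX}$ may also be supplied by rule 8). **Laws of the square of opposition.** The laws of contradiction are the two consequences in (1). The remaining laws (subalternation, contrariety, subcontrariety, all under existential import on $X$) are condensed into the two consequences in (2), where $\mathbf{O}_{XY}$ is regarded as the negation of $\mathbf{A}_{XY}$ and $\mathbf{I}_{XY}$ as the negation of $\mathbf{E}_{XY}$, and vice versa. -}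

module Defs where

open import Data.Nat using (ℕ)
open import Data.List using (List; []; _∷_; [_]; _++_)
open import Data.List.Relation.Unary.All using (All; []; _∷_)
open import Data.List.Relation.Binary.Permutation.Propositional using (_↭_)
open import Data.Product using (∃-syntax; _×_)

infix 4 _HasLeaves_ _HaveLeaves_
infix 3 _⨾_⊢_

TermVariable : Set
TermVariable = ℕ

data Component : Set where
  ⟶ ⟵ • : Component
  var     : TermVariable → Component

Expression : Set
Expression = List Component

data IsArrow : Component → Set where
  ⟶ : IsArrow ⟶
  ⟵ : IsArrow ⟵

data IsSeparator : Component → Set where
  •   : IsSeparator •
  var : ∀ A → IsSeparator (var A)

-- Separators and arrows alternate, from a separator to a final term-variable.
data IsChain : Expression → Set where
  end  : ∀ A → IsChain [ var A ]
  step : ∀ {s a cs} → IsSeparator s → IsArrow a → IsChain cs →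
         IsChain (s ∷ a ∷ cs)

data IsDiagram : Expression → Set where
  diagram : ∀ {A cs} → IsChain (var A ∷ cs) → IsDiagram (var A ∷ cs)

data Proposition : Set where
  𝐀 𝐄 𝐈 𝐎 : TermVariable → TermVariable → Proposition

⟦_⟧ : Proposition → Expression
⟦ 𝐀 A B ⟧ = var A ∷ ⟶ ∷ var B ∷ []
⟦ 𝐄 A B ⟧ = var A ∷ ⟶ ∷ • ∷ ⟵ ∷ var B ∷ []
⟦ 𝐈 A B ⟧ = var A ∷ ⟵ ∷ • ∷ ⟶ ∷ var B ∷ []
⟦ 𝐎 A B ⟧ = var A ∷ ⟵ ∷ • ∷ ⟶ ∷ • ∷ ⟵ ∷ var B ∷ []

-- Rule Ps C: C is inferred from the hypotheses Ps, up to the requirement that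
-- all of these be diagrams, which ProofTree imposes at every node.  Under that
-- requirement 𝒟 and ℰ, being segments of diagrams, are exactly parts.
data Rule : List Expression → Expression → Set where
  rule1  : ∀ A B → Rule [ var A ∷ ⟶ ∷ var B ∷ [] ] (var B ∷ ⟵ ∷ var A ∷ [])
  rule1⁻ : ∀ A B → Rule [ var B ∷ ⟵ ∷ var A ∷ [] ] (var A ∷ ⟶ ∷ var B ∷ [])
  rule2  : ∀ A B → Rule [ var A ∷ ⟶ ∷ • ∷ ⟵ ∷ var B ∷ [] ]
                        (var B ∷ ⟶ ∷ • ∷ ⟵ ∷ var A ∷ [])
  rule3  : ∀ A B → Rule [ var A ∷ ⟵ ∷ • ∷ ⟶ ∷ var B ∷ [] ]
                        (var B ∷ ⟵ ∷ • ∷ ⟶ ∷ var A ∷ [])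
  rule4  : ∀ A B → Rule [ var A ∷ ⟵ ∷ • ∷ ⟶ ∷ • ∷ ⟵ ∷ var B ∷ [] ]
                        (var B ∷ ⟶ ∷ • ∷ ⟵ ∷ • ∷ ⟶ ∷ var A ∷ [])
  rule4⁻ : ∀ A B → Rule [ var B ∷ ⟶ ∷ • ∷ ⟵ ∷ • ∷ ⟶ ∷ var A ∷ [] ]
                        (var A ∷ ⟵ ∷ • ∷ ⟶ ∷ • ∷ ⟵ ∷ var B ∷ [])
  rule5  : ∀ 𝒟 A ℰ → Rule ((𝒟 ++ [ var A ]) ∷ (var A ∷ ℰ) ∷ []) (𝒟 ++ var A ∷ ℰ)
  rule5′ : ∀ 𝒟 A ℰ → Rule ((var A ∷ ℰ) ∷ (𝒟 ++ [ var A ]) ∷ []) (𝒟 ++ var A ∷ ℰ)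
  rule6  : ∀ 𝒟 A ℰ → Rule [ 𝒟 ++ ⟶ ∷ var A ∷ ⟶ ∷ ℰ ] (𝒟 ++ ⟶ ∷ ℰ)
  rule7  : ∀ 𝒟 A ℰ → Rule [ 𝒟 ++ ⟵ ∷ var A ∷ ⟵ ∷ ℰ ] (𝒟 ++ ⟵ ∷ ℰ)
  rule8  : ∀ A → Rule [] (var A ∷ ⟵ ∷ • ∷ ⟶ ∷ var A ∷ [])

data ProofTree : Expression → Set where
  leaf : ∀ {D} → IsDiagram D → ProofTree D
  node : ∀ {Ps C} → IsDiagram C → Rule Ps C → All ProofTree Ps → ProofTree C

-- The list of premises at the leaves, from left to right and with repetitions.
-- An instance of rule 8 either contributes no premise (by node) or supplies
-- the premise 𝐈 A A (by supplied).
mutual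
  data _HasLeaves_ : ∀ {D} → ProofTree D → List Expression → Set where
    leaf     : ∀ {D} {d : IsDiagram D} → leaf d HasLeaves [ D ]
    node     : ∀ {Ps C Γ} {c : IsDiagram C} {r : Rule Ps C} {ts : All ProofTree Ps} →
               ts HaveLeaves Γ → node c r ts HasLeaves Γ
    supplied : ∀ {A} {c : IsDiagram ⟦ 𝐈 A A ⟧} →
               node c (rule8 A) [] HasLeaves [ ⟦ 𝐈 A A ⟧ ]

  data _HaveLeaves_ : ∀ {Ps} → All ProofTree Ps → List Expression → Set where
    []  : [] HaveLeaves []
    _∷_ : ∀ {P Ps Γ Δ} {t : ProofTree P} {ts : All ProofTree Ps} →
          t HasLeaves Γ → ts HaveLeaves Δ → (t ∷ ts) HaveLeaves (Γ ++ Δ)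

-- The two premises are the only ones and each occurs at exactly one leaf; their
-- left-to-right order in the tree is immaterial.
_⨾_⊢_ : Proposition → Proposition → Proposition → Set
P₁ ⨾ P₂ ⊢ C =
  ∃[ t ] ∃[ Γ ] _HasLeaves_ {⟦ C ⟧} t Γ × Γ ↭ ⟦ P₁ ⟧ ∷ ⟦ P₂ ⟧ ∷ []

{-# OPTIONS --safe #-}
-- In each law one premise (𝐎 X Y, 𝐈 X Y or 𝐈 X X) begins X ← • →.  Append the
-- other premise, reversed by rule 1 or 2 in the laws of contradiction, on its
-- right: the overlap then lies between two arrows of the same direction, so
-- rule 6 or 7 deletes it and leaves the conclusion.
module Submission where

open import Data.List using (List; []; _∷_; [_]; _++_)
open import Data.List.Relation.Binary.Permutation.Propositional using (↭-refl)
open import Data.List.Relation.Unary.All using ([]; _∷_)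
open import Data.Product using (∃-syntax; _×_; _,_)
open import Defs

infix 3 _⊢_

_⊢_ : List Expression → Expression → Set
Γ ⊢ D = ∃[ t ] _HasLeaves_ {D} t Γ

isDiagram : ∀ P → IsDiagram ⟦ P ⟧
isDiagram (𝐀 A B) = diagram (step (var A) ⟶ (end B))
isDiagram (𝐄 A B) = diagram (step (var A) ⟶ (step • ⟵ (end B)))
isDiagram (𝐈 A B) = diagram (step (var A) ⟵ (step • ⟶ (end B)))
isDiagram (𝐎 A B) = diagram (step (var A) ⟵ (step • ⟶ (step • ⟵ (end B))))

-- Chains grow by separator-arrow pairs, so the induction strips two components of `𝒟` at a time. A
-- one-element `𝒟` is impossible: `var A` would stand where an arrow must.
++-isChain : ∀ 𝒟 {A ℰ} → IsChain (𝒟 ++ [ var A ]) → IsChain (var A ∷ ℰ) →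
             IsChain (𝒟 ++ var A ∷ ℰ)
++-isChain []              _            d = d
++-isChain (_ ∷ [])        (step _ () _)
++-isChain (_ ∷ _ ∷ 𝒟)     (step s a c) d = step s a (++-isChain 𝒟 c d)

++-isDiagram : ∀ 𝒟 {A ℰ} → IsDiagram (𝒟 ++ [ var A ]) → IsDiagram (var A ∷ ℰ) →
               IsDiagram (𝒟 ++ var A ∷ ℰ)
++-isDiagram []          _           d           = d
++-isDiagram (var B ∷ 𝒟) (diagram c) (diagram d) = diagram (++-isChain (var B ∷ 𝒟) c d)

-- Every tree certifies its root, which lets `join` draw its diagram evidence from its two inputs.
conclusion-isDiagram : ∀ {Γ D} → Γ ⊢ D → IsDiagram D
conclusion-isDiagram (leaf d , _)     = d
conclusion-isDiagram (node c _ _ , _) = c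

premise : ∀ P → [ ⟦ P ⟧ ] ⊢ ⟦ P ⟧
premise P = leaf (isDiagram P) , leaf

infer : ∀ {P C Γ} → IsDiagram C → Rule [ P ] C → Γ ⊢ P → Γ ++ [] ⊢ C
infer c r (t , l) = node c r (t ∷ []) , node (l ∷ [])

-- With `rule5′` the right-hand part comes first, so the leaves of each law appear in the order of
-- its premises and `↭-refl` suffices in `conclude`.
join : ∀ 𝒟 {A ℰ Γ Δ} → Γ ⊢ var A ∷ ℰ → Δ ⊢ 𝒟 ++ [ var A ] →
       Γ ++ Δ ++ [] ⊢ 𝒟 ++ var A ∷ ℰ
join 𝒟 {A} {ℰ} p@(t , l) q@(u , m) =
  node (++-isDiagram 𝒟 (conclusion-isDiagram q) (conclusion-isDiagram p))
       (rule5′ 𝒟 A ℰ) (t ∷ u ∷ []) ,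
  node (l ∷ m ∷ [])

conclude : ∀ {P₁ P₂ C} → ⟦ P₁ ⟧ ∷ ⟦ P₂ ⟧ ∷ [] ⊢ ⟦ C ⟧ → P₁ ⨾ P₂ ⊢ C
conclude (t , l) = t , _ , l , ↭-refl

proposition4p1 : (X Y : TermVariable) →
    ((𝐀 X Y ⨾ 𝐎 X Y ⊢ 𝐎 X X) × (𝐄 X Y ⨾ 𝐈 X Y ⊢ 𝐎 X X)) ×
    ((𝐀 X Y ⨾ 𝐈 X X ⊢ 𝐈 X Y) × (𝐄 X Y ⨾ 𝐈 X X ⊢ 𝐎 X Y))
proposition4p1 X Y = (contradiction-𝐀𝐎 , contradiction-𝐄𝐈) , (𝐀-implies-𝐈 , 𝐄-implies-𝐎)
  where
  someX : Expression
  someX = var X ∷ ⟵ ∷ • ∷ []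

  contradiction-𝐀𝐎 : 𝐀 X Y ⨾ 𝐎 X Y ⊢ 𝐎 X X
  contradiction-𝐀𝐎 = conclude {𝐀 X Y} {𝐎 X Y} {𝐎 X X}
    -- The joined diagram is X ← • → • ← Y ← X, and Y is deleted.
    (infer (isDiagram (𝐎 X X)) (rule7 (someX ++ ⟶ ∷ • ∷ []) Y [ var X ])
      (join (someX ++ ⟶ ∷ • ∷ ⟵ ∷ [])
        (infer (diagram (step (var Y) ⟵ (end X))) (rule1 X Y) (premise (𝐀 X Y)))
        (premise (𝐎 X Y))))

  contradiction-𝐄𝐈 : 𝐄 X Y ⨾ 𝐈 X Y ⊢ 𝐎 X X
  contradiction-𝐄𝐈 = conclude {𝐄 X Y} {𝐈 X Y} {𝐎 X X}
    -- The joined diagram is X ← • → Y → • ← X, and Y is deleted.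
    (infer (isDiagram (𝐎 X X)) (rule6 someX Y (• ∷ ⟵ ∷ var X ∷ []))
      (join (someX ++ [ ⟶ ])
        (infer (isDiagram (𝐄 Y X)) (rule2 X Y) (premise (𝐄 X Y)))
        (premise (𝐈 X Y))))

  𝐀-implies-𝐈 : 𝐀 X Y ⨾ 𝐈 X X ⊢ 𝐈 X Y
  𝐀-implies-𝐈 = conclude {𝐀 X Y} {𝐈 X X} {𝐈 X Y}
    -- From X ← • → X → Y the inner X is deleted.
    (infer (isDiagram (𝐈 X Y)) (rule6 someX X [ var Y ])
      (join (someX ++ [ ⟶ ]) (premise (𝐀 X Y)) (premise (𝐈 X X))))

  𝐄-implies-𝐎 : 𝐄 X Y ⨾ 𝐈 X X ⊢ 𝐎 X Y
  𝐄-implies-𝐎 = conclude {𝐄 X Y} {𝐈 X X} {𝐎 X Y}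
    -- From X ← • → X → • ← Y the inner X is deleted.
    (infer (isDiagram (𝐎 X Y)) (rule6 someX X (• ∷ ⟵ ∷ var Y ∷ []))
      (join (someX ++ [ ⟶ ]) (premise (𝐄 X Y)) (premise (𝐈 X X))))
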